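{- Let $\mathcal{G}$ be the smallest class of coherent graphs containing the one-vertex graphs without edges and closed under the two operations $(G,H)\mapsto G\otimes H$ and $(G,H)\mapsto G\mathbin{\mathrm{par}} H$ on coherent graphs with disjoint vertex sets. Then the coherence relation of every graph in $\mathcal{G}$ is the chordless coherence relation on its set of edges.
   Context: Graphs are directed multigraphs (vertex set $V(G)$, edge set $E(G)$, source and target maps). A coherent graph is a graph with a coherence relation, i.e. a symmetric reflexive binary relation, on its set of edges; two edges are incoherent if they are not coherent. For coherent graphs $G,H$ with $V(G)\cap V(H)=\emptyset$: - $G\otimes H$ has vertex set $V(G)\sqcup V(H)$ and edge set $E(G)\sqcup E(H)$; its coherence restricts to those of $G$ and $H$, and every edge of $G$ is coherent with every edge of $H$. - $G\mathbin{\mathrm{par}} H$ has vertex set $V(G)\sqcup V(H)$; its edges are those of $G$, those of $H$ and, for each $u\in V(G)$ and $v\in V(H)$, two additional edges, one from $u$ to $v$ and one from $v$ to $u$; its coherence restricts to those of $G$ and $H$, every edge of $G$ is incoherent with every edge of $H$, and each additional edge is incoherent with all other edges. Two edges are incident if they have a common endpoint (regardless of direction). The chordless coherence relation on a graph $G$: two distinct edges $e,f\in E(G)$ are incoherent if and only if either $e$ and $f$ are incident, or some $g\in E(G)$ is incident to both $e$ and $f$ (every edge is coherent with itself). -}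

module Defs where

open import Level using (Level; suc)
open import Data.Product using (_×_; ∃-syntax)
open import Data.Sum using (_⊎_; inj₁; inj₂; map)
open import Function.Bundles using (_⇔_)
open import Relation.Binary.Core using (Rel)
open import Relation.Binary.Definitions using (Reflexive; Symmetric)
open import Relation.Binary.PropositionalEquality using (_≡_; _≢_)
open import Relation.Nullary using (¬_)

record Graph (ℓ : Level) : Set (suc ℓ) where
  field
    V      : Set ℓ
    E      : Set ℓ
    source : E → V
    target : E → V

  _EndpointOf_ : V → E → Set ℓ
  v EndpointOf e = source e ≡ v ⊎ target e ≡ v

  Incident : Rel E ℓ
  Incident e f = ∃[ v ] (v EndpointOf e × v EndpointOf f)

record CoherentGraph (ℓ : Level) : Set (suc ℓ) where
  field
    graph   : Graph ℓ

  open Graph graph public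

  infix 4 _⌢_

  field
    _⌢_     : Rel E ℓ
    ⌢-refl  : Reflexive _⌢_
    ⌢-sym   : Symmetric _⌢_

module _ {ℓ : Level} (G H : CoherentGraph ℓ) where

  private
    module G = CoherentGraph G
    module H = CoherentGraph H

  -- A sum of types is a disjoint union, so V(G) ∩ V(H) = ∅ needs no hypothesis.

  ⊗-graph : Graph ℓ
  ⊗-graph = record
    { V      = G.V ⊎ H.V
    ; E      = G.E ⊎ H.E
    ; source = map G.source H.source
    ; target = map G.target H.target
    }

  data ⊗-Coh : Rel (G.E ⊎ H.E) ℓ where
    left       : ∀ {e f} → e G.⌢ f → ⊗-Coh (inj₁ e) (inj₁ f)
    right      : ∀ {e f} → e H.⌢ f → ⊗-Coh (inj₂ e) (inj₂ f)
    left-right : ∀ {e f} → ⊗-Coh (inj₁ e) (inj₂ f)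
    right-left : ∀ {e f} → ⊗-Coh (inj₂ e) (inj₁ f)

  infixr 6 _⊗_

  _⊗_ : CoherentGraph ℓ
  _⊗_ = record
    { graph  = ⊗-graph
    ; _⌢_    = ⊗-Coh
    ; ⌢-refl = λ { {inj₁ _} → left G.⌢-refl ; {inj₂ _} → right H.⌢-refl }
    ; ⌢-sym  = λ { (left c)   → left (G.⌢-sym c)
                 ; (right c)  → right (H.⌢-sym c)
                 ; left-right → right-left
                 ; right-left → left-right
                 }
    }

  data par-E : Set ℓ where
    left  : G.E → par-E
    right : H.E → par-E
    forth : G.V → H.V → par-E
    back  : G.V → H.V → par-E

  par-source : par-E → G.V ⊎ H.V
  par-source (left e)    = inj₁ (G.source e)
  par-source (right e)   = inj₂ (H.source e)
  par-source (forth u v) = inj₁ u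
  par-source (back u v)  = inj₂ v

  par-target : par-E → G.V ⊎ H.V
  par-target (left e)    = inj₁ (G.target e)
  par-target (right e)   = inj₂ (H.target e)
  par-target (forth u v) = inj₂ v
  par-target (back u v)  = inj₁ u

  par-graph : Graph ℓ
  par-graph = record
    { V      = G.V ⊎ H.V
    ; E      = par-E
    ; source = par-source
    ; target = par-target
    }

  -- An additional edge is coherent with itself only.
  data par-Coh : Rel par-E ℓ where
    left  : ∀ {e f} → e G.⌢ f → par-Coh (left e) (left f)
    right : ∀ {e f} → e H.⌢ f → par-Coh (right e) (right f)
    forth : ∀ {u v} → par-Coh (forth u v) (forth u v)
    back  : ∀ {u v} → par-Coh (back u v) (back u v)

  infixr 6 _par_

  _par_ : CoherentGraph ℓ
  _par_ = record
    { graph  = par-graph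
    ; _⌢_    = par-Coh
    ; ⌢-refl = λ { {left _}    → left G.⌢-refl
                 ; {right _}   → right H.⌢-refl
                 ; {forth _ _} → forth
                 ; {back _ _}  → back
                 }
    ; ⌢-sym  = λ { (left c)  → left (G.⌢-sym c)
                 ; (right c) → right (H.⌢-sym c)
                 ; forth     → forth
                 ; back      → back
                 }
    }

module _ {ℓ : Level} (G : CoherentGraph ℓ) where

  open CoherentGraph G

  record IsEdgelessVertex : Set ℓ where
    field
      vertex  : V
      unique  : ∀ v → v ≡ vertex
      no-edge : ¬ E

data 𝒢 {ℓ : Level} : CoherentGraph ℓ → Set (suc ℓ) where
  one-vertex : ∀ {G} → IsEdgelessVertex G → 𝒢 G
  ⊗-closed   : ∀ {G H} → 𝒢 G → 𝒢 H → 𝒢 (G ⊗ H)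
  par-closed : ∀ {G H} → 𝒢 G → 𝒢 H → 𝒢 (G par H)

module _ {ℓ : Level} (G : Graph ℓ) where

  open Graph G

  record IsChordlessCoherence (_⌢_ : Rel E ℓ) : Set ℓ where
    field
      reflexive  : Reflexive _⌢_
      incoherent : ∀ {e f} → e ≢ f →
        (¬ (e ⌢ f)) ⇔ (Incident e f ⊎ (∃[ g ] (Incident g e × Incident g f)))

{-# OPTIONS --safe #-}
-- The operands of ⊗ and par embed into the result, and every edge of the result outside the image
-- of an operand has at most one endpoint in that operand. Such an edge cannot link two edges of the
-- operand that are not already incident, so the chordless relation restricts to that of the operand.
-- Across the operands, ⊗ has no connecting edge; in par, an edge with an endpoint u of G and an edge
-- with an endpoint v of H are linked by the additional edge from u to v.
module Submission where

open import Level using (Level)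
open import Data.Empty using (⊥-elim)
open import Data.Product using (_×_; _,_; ∃-syntax)
open import Data.Sum using (_⊎_; inj₁; inj₂)
open import Data.Sum.Properties using (inj₁-injective; inj₂-injective)
open import Function.Base using (_∘_)
open import Function.Bundles using (_⇔_; mk⇔; module Equivalence)
open import Function.Definitions using (Injective)
open import Relation.Binary.Core using (Rel)
open import Relation.Binary.PropositionalEquality
  using (_≡_; _≢_; refl; sym; trans; cong; subst)
open import Relation.Nullary using (¬_)

open import Defs

open IsChordlessCoherence

module _ {ℓ : Level} (G : Graph ℓ) where

  open Graph G

  -- The condition on the right of `incoherent`; the connecting edge `g` may be `e` or `f` itself.
  Linked : Rel E ℓ
  Linked e f = Incident e f ⊎ (∃[ g ] (Incident g e × Incident g f))

  Incident-sym : ∀ e f → Incident e f → Incident f e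
  Incident-sym _ _ (v , v∈e , v∈f) = v , v∈f , v∈e

  Linked-sym : ∀ e f → Linked e f → Linked f e
  Linked-sym e f (inj₁ i)           = inj₁ (Incident-sym e f i)
  Linked-sym _ _ (inj₂ (g , i , j)) = inj₂ (g , j , i)

module Embedding {ℓ : Level} (G K : Graph ℓ)
  (ι : Graph.V G → Graph.V K) (ι-injective : Injective _≡_ _≡_ ι)
  (ε : Graph.E G → Graph.E K)
  (ε-source : ∀ e → Graph.source K (ε e) ≡ ι (Graph.source G e))
  (ε-target : ∀ e → Graph.target K (ε e) ≡ ι (Graph.target G e))
  where

  private
    module G = Graph G
    module K = Graph K

  endpoint⁺ : ∀ {v e} → v G.EndpointOf e → ι v K.EndpointOf ε e
  endpoint⁺ {e = e} (inj₁ refl) = inj₁ (ε-source e)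
  endpoint⁺ {e = e} (inj₂ refl) = inj₂ (ε-target e)

  endpoint⁻ : ∀ {v e} → ι v K.EndpointOf ε e → v G.EndpointOf e
  endpoint⁻ {e = e} (inj₁ p) = inj₁ (ι-injective (trans (sym (ε-source e)) p))
  endpoint⁻ {e = e} (inj₂ p) = inj₂ (ι-injective (trans (sym (ε-target e)) p))

  endpoint-image : ∀ {w e} → w K.EndpointOf ε e → ∃[ v ] ι v ≡ w
  endpoint-image {e = e} (inj₁ p) = G.source e , trans (sym (ε-source e)) p
  endpoint-image {e = e} (inj₂ p) = G.target e , trans (sym (ε-target e)) p

  -- The vertex shared with `ε e` is an endpoint of `ε e`, hence lies in the image of `ι`, even when
  -- `g` is an arbitrary edge of `K`.
  incident-endpoint : ∀ {g e} → K.Incident g (ε e) →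
    ∃[ v ] (ι v K.EndpointOf g × v G.EndpointOf e)
  incident-endpoint (w , w∈g , w∈e) with endpoint-image w∈e
  ... | v , refl = v , w∈g , endpoint⁻ w∈e

  incident⁺ : ∀ {e f} → G.Incident e f → K.Incident (ε e) (ε f)
  incident⁺ (v , v∈e , v∈f) = ι v , endpoint⁺ v∈e , endpoint⁺ v∈f

  incident⁻ : ∀ {e f} → K.Incident (ε e) (ε f) → G.Incident e f
  incident⁻ i with incident-endpoint i
  ... | v , v∈e , v∈f = v , endpoint⁻ v∈e , v∈f

  linked⁺ : ∀ {e f} → Linked G e f → Linked K (ε e) (ε f)
  linked⁺ (inj₁ i)           = inj₁ (incident⁺ i)
  linked⁺ (inj₂ (g , i , j)) = inj₂ (ε g , incident⁺ i , incident⁺ j)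

  AtMostOneEndpoint : K.E → Set ℓ
  AtMostOneEndpoint g = ∀ {v w} → ι v K.EndpointOf g → ι w K.EndpointOf g → v ≡ w

  module _ (image? : ∀ g → (∃[ g′ ] ε g′ ≡ g) ⊎ AtMostOneEndpoint g) where

    linked⁻ : ∀ {e f} → Linked K (ε e) (ε f) → Linked G e f
    linked⁻ (inj₁ i) = inj₁ (incident⁻ i)
    linked⁻ {f = f} (inj₂ (g , i , j)) with image? g
    ... | inj₁ (g′ , refl) = inj₂ (g′ , incident⁻ i , incident⁻ j)
    -- The vertices at which `g` meets the two images both come from `G`, so they coincide and the
    -- link through `g` collapses to incidence.
    ... | inj₂ one with incident-endpoint i | incident-endpoint j
    ...   | v , v∈g , v∈e | w , w∈g , w∈f =
      inj₁ (v , v∈e , subst (G._EndpointOf f) (one w∈g v∈g) w∈f)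

    -- Coherence and linkedness are both preserved and reflected by `ε`, so the equivalence carries
    -- over; distinct images have distinct preimages by `cong ε`.
    incoherent⁺ : ∀ (_⌢_ : Rel G.E ℓ) (_⌢′_ : Rel K.E ℓ) →
      IsChordlessCoherence G _⌢_ →
      (∀ {e f} → e ⌢ f → ε e ⌢′ ε f) → (∀ {e f} → ε e ⌢′ ε f → e ⌢ f) →
      ∀ e f → ε e ≢ ε f → (¬ (ε e ⌢′ ε f)) ⇔ Linked K (ε e) (ε f)
    incoherent⁺ _ _ c ⌢⁺ ⌢⁻ e f e≢f = mk⇔
      (λ ¬coh → linked⁺ {e} {f} (to (¬coh ∘ ⌢⁺)))
      (λ l → from (linked⁻ {e} {f} l) ∘ ⌢⁻)
      where open Equivalence (incoherent c (e≢f ∘ cong ε))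

module _ {ℓ : Level} (G H : CoherentGraph ℓ) where

  private
    module G = CoherentGraph G
    module H = CoherentGraph H
    module ⊗ = CoherentGraph (G ⊗ H)
    module par = CoherentGraph (G par H)

  -- A common endpoint would lie in both summands of the vertex set.
  ⊗-separated : ∀ e f → ¬ ⊗.Incident (inj₁ e) (inj₂ f)
  ⊗-separated _ _ (_ , inj₁ refl , inj₁ ())
  ⊗-separated _ _ (_ , inj₁ refl , inj₂ ())
  ⊗-separated _ _ (_ , inj₂ refl , inj₁ ())
  ⊗-separated _ _ (_ , inj₂ refl , inj₂ ())

  -- A connecting edge belongs to one operand, so it would be incident to an edge of the other.
  ⊗-unlinked : ∀ e f → ¬ Linked ⊗.graph (inj₁ e) (inj₂ f)
  ⊗-unlinked e f (inj₁ i)                = ⊗-separated e f i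
  ⊗-unlinked e f (inj₂ (inj₁ g , _ , j)) = ⊗-separated g f j
  ⊗-unlinked e f (inj₂ (inj₂ g , i , _)) =
    ⊗-separated e g (Incident-sym ⊗.graph (inj₂ g) (inj₁ e) i)

  private
    module ⊗ˡ = Embedding G.graph ⊗.graph inj₁ inj₁-injective inj₁ (λ _ → refl) (λ _ → refl)
    module ⊗ʳ = Embedding H.graph ⊗.graph inj₂ inj₂-injective inj₂ (λ _ → refl) (λ _ → refl)

  ⊗-imageˡ? : ∀ g → (∃[ g′ ] inj₁ g′ ≡ g) ⊎ ⊗ˡ.AtMostOneEndpoint g
  ⊗-imageˡ? (inj₁ g) = inj₁ (g , refl)
  ⊗-imageˡ? (inj₂ _) = inj₂ λ { (inj₁ ()) _ ; (inj₂ ()) _ }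

  ⊗-imageʳ? : ∀ g → (∃[ g′ ] inj₂ g′ ≡ g) ⊎ ⊗ʳ.AtMostOneEndpoint g
  ⊗-imageʳ? (inj₁ _) = inj₂ λ { (inj₁ ()) _ ; (inj₂ ()) _ }
  ⊗-imageʳ? (inj₂ g) = inj₁ (g , refl)

  ⊗-chordless : IsChordlessCoherence G.graph G._⌢_ → IsChordlessCoherence H.graph H._⌢_ →
    IsChordlessCoherence ⊗.graph ⊗._⌢_
  ⊗-chordless c d .reflexive = ⊗.⌢-refl
  ⊗-chordless c d .incoherent {inj₁ e} {inj₁ f} =
    ⊗ˡ.incoherent⁺ ⊗-imageˡ? G._⌢_ ⊗._⌢_ c left (λ { (left p) → p }) e f
  ⊗-chordless c d .incoherent {inj₂ e} {inj₂ f} =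
    ⊗ʳ.incoherent⁺ ⊗-imageʳ? H._⌢_ ⊗._⌢_ d right (λ { (right p) → p }) e f
  -- Across the operands both sides of the equivalence are false.
  ⊗-chordless c d .incoherent {inj₁ e} {inj₂ f} _ =
    mk⇔ (λ ¬coh → ⊥-elim (¬coh left-right)) (λ l → ⊥-elim (⊗-unlinked e f l))
  ⊗-chordless c d .incoherent {inj₂ e} {inj₁ f} _ =
    mk⇔ (λ ¬coh → ⊥-elim (¬coh right-left))
        (λ l → ⊥-elim (⊗-unlinked f e (Linked-sym ⊗.graph (inj₂ e) (inj₁ f) l)))

  across-linked : ∀ {u v} e f → inj₁ u par.EndpointOf e → inj₂ v par.EndpointOf f →
    Linked par.graph e f
  across-linked {u} {v} _ _ u∈e v∈f =
    inj₂ (forth u v , (inj₁ u , inj₁ refl , u∈e) , (inj₂ v , inj₂ refl , v∈f))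

  -- Since `e` touches both operands, it always has an endpoint on the side opposite to a given
  -- endpoint of `f`, and `across-linked` applies to that pair.
  additional-linked : ∀ {u v} e → inj₁ u par.EndpointOf e → inj₂ v par.EndpointOf e →
    ∀ f → Linked par.graph e f
  additional-linked e u∈e v∈e = link
    where
    link-to-G : ∀ {w} f → inj₁ w par.EndpointOf f → Linked par.graph e f
    link-to-G f w∈f = Linked-sym par.graph f e (across-linked f e w∈f v∈e)

    link : ∀ f → Linked par.graph e f
    -- The endpoint chosen for `f` is its source throughout.
    link f@(left _)    = link-to-G f (inj₁ refl)
    link f@(right _)   = across-linked e f u∈e (inj₁ refl)
    link f@(forth _ _) = link-to-G f (inj₁ refl)
    link f@(back _ _)  = across-linked e f u∈e (inj₁ refl)

  forth-linked : ∀ u v f → Linked par.graph (forth u v) f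
  forth-linked u v = additional-linked (forth u v) (inj₁ refl) (inj₂ refl)

  back-linked : ∀ u v f → Linked par.graph (back u v) f
  back-linked u v = additional-linked (back u v) (inj₂ refl) (inj₁ refl)

  forth-coherent : ∀ {u v f} → forth u v par.⌢ f → forth u v ≡ f
  forth-coherent forth = refl

  back-coherent : ∀ {u v f} → back u v par.⌢ f → back u v ≡ f
  back-coherent back = refl

  private
    module parˡ = Embedding G.graph par.graph inj₁ inj₁-injective left (λ _ → refl) (λ _ → refl)
    module parʳ = Embedding H.graph par.graph inj₂ inj₂-injective right (λ _ → refl) (λ _ → refl)

  par-imageˡ? : ∀ g → (∃[ g′ ] left g′ ≡ g) ⊎ parˡ.AtMostOneEndpoint g
  par-imageˡ? (left g)    = inj₁ (g , refl)
  par-imageˡ? (right _)   = inj₂ λ { (inj₁ ()) _ ; (inj₂ ()) _ }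
  -- The only endpoint in `G` is the source of a `forth` edge and the target of a `back` edge.
  par-imageˡ? (forth _ _) = inj₂ λ { (inj₁ refl) (inj₁ refl) → refl }
  par-imageˡ? (back _ _)  = inj₂ λ { (inj₂ refl) (inj₂ refl) → refl }

  par-imageʳ? : ∀ g → (∃[ g′ ] right g′ ≡ g) ⊎ parʳ.AtMostOneEndpoint g
  par-imageʳ? (left _)    = inj₂ λ { (inj₁ ()) _ ; (inj₂ ()) _ }
  par-imageʳ? (right g)   = inj₁ (g , refl)
  par-imageʳ? (forth _ _) = inj₂ λ { (inj₂ refl) (inj₂ refl) → refl }
  par-imageʳ? (back _ _)  = inj₂ λ { (inj₁ refl) (inj₁ refl) → refl }

  par-chordless : IsChordlessCoherence G.graph G._⌢_ → IsChordlessCoherence H.graph H._⌢_ →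
    IsChordlessCoherence par.graph par._⌢_
  par-chordless c d .reflexive = par.⌢-refl
  par-chordless c d .incoherent {left e} {left f} =
    parˡ.incoherent⁺ par-imageˡ? G._⌢_ par._⌢_ c left (λ { (left p) → p }) e f
  par-chordless c d .incoherent {right e} {right f} =
    parʳ.incoherent⁺ par-imageʳ? H._⌢_ par._⌢_ d right (λ { (right p) → p }) e f
  -- Across the operands both sides of the equivalence hold: the sources supply the link, and no
  -- constructor of `par-Coh` relates the edges.
  par-chordless c d .incoherent {e@(left _)} {f@(right _)} _ =
    mk⇔ (λ _ → across-linked e f (inj₁ refl) (inj₁ refl)) (λ _ ())
  par-chordless c d .incoherent {e@(right _)} {f@(left _)} _ =
    mk⇔ (λ _ → Linked-sym par.graph f e (across-linked f e (inj₁ refl) (inj₁ refl))) (λ _ ())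
  -- For an additional edge both sides hold again: it is linked to every edge, and coherence would
  -- force equality, against `e≢f`.
  par-chordless c d .incoherent {forth u v} {f} e≢f =
    mk⇔ (λ _ → forth-linked u v f) (λ _ → e≢f ∘ forth-coherent)
  par-chordless c d .incoherent {back u v} {f} e≢f =
    mk⇔ (λ _ → back-linked u v f) (λ _ → e≢f ∘ back-coherent)
  par-chordless c d .incoherent {e} {forth u v} e≢f =
    mk⇔ (λ _ → Linked-sym par.graph (forth u v) e (forth-linked u v e))
        (λ _ → e≢f ∘ sym ∘ forth-coherent ∘ par.⌢-sym)
  par-chordless c d .incoherent {e} {back u v} e≢f =
    mk⇔ (λ _ → Linked-sym par.graph (back u v) e (back-linked u v e))
        (λ _ → e≢f ∘ sym ∘ back-coherent ∘ par.⌢-sym)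

proposition39 : ∀ {ℓ : Level} (G : CoherentGraph ℓ) → 𝒢 G →
    IsChordlessCoherence (CoherentGraph.graph G) (CoherentGraph._⌢_ G)
proposition39 G (one-vertex i) = record
  { reflexive  = CoherentGraph.⌢-refl G
  ; incoherent = λ {e} _ → ⊥-elim (IsEdgelessVertex.no-edge i e)
  }
proposition39 _ (⊗-closed {G} {H} g h) =
  ⊗-chordless G H (proposition39 G g) (proposition39 H h)
proposition39 _ (par-closed {G} {H} g h) =
  par-chordless G H (proposition39 G g) (proposition39 H h)
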